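{- Let $\mathbf a$ be a non-empty admissible composition and let $\varepsilon_1\ldots\varepsilon_k=\mathbf w(\mathbf a)$ be its binary word. For $1\le i\le k-1$, let $\mathbf a_i$ and $\mathbf b_i$ be the compositions whose binary words are $\varepsilon_{i+1}\ldots\varepsilon_k$ and $\overline{\varepsilon_i}\ldots\overline{\varepsilon_1}$ respectively. Then $$\zeta(\mathbf a)=\sum_{m=1}^{\infty}\psi_m(\mathbf a)\binom{2m}{m}^{ -1},\qquad \psi_m(\mathbf a)=\sum_{i=1}^{k-1}\lambda(\varepsilon_i,\varepsilon_{i+1})\,\varphi_m(\mathbf a_i)\,\varphi_m(\mathbf b_i).$$
   Context: A composition is a finite sequence $(a_1,\ldots,a_r)$ of positive integers; it is admissible if $r\ge1$ and $a_1\ge2$, or $r=0$. For admissible non-empty $\mathbf a$, $\zeta(\mathbf a)=\sum_{n_1>\cdots>n_r>0}n_1^{ -a_1}\cdots n_r^{ -a_r}$. The binary word of a composition is $\mathbf w(a_1,\ldots,a_r)=\{0\}_{a_1-1}1\cdots\{0\}_{a_r-1}1$ ($\{0\}_u$ = $u$ letters $0$); $\mathbf w$ is a bijection from compositions onto binary words that are empty or end with $1$. $\overline0=1$, $\overline1=0$. For a non-empty composition $\mathbf c=(c_1,\ldots,c_r)$ and an integer $m\ge1$, $\varphi_m(\mathbf c)=m^{ -c_1}\sum_{m>n_2>\cdots>n_r>0}n_2^{ -c_2}\cdots n_r^{ -c_r}$ (equal to $m^{ -c_1}$ if $r=1$). For bits $\varepsilon,\varepsilon'$: $\lambda(1,0)=1$,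 $\lambda(0,0)=\lambda(1,1)=2$, $\lambda(0,1)=3$. -}

module Defs where

open import Data.Bool using (Bool; true; false; not)
open import Data.Nat as ℕ using (ℕ; zero; suc; _∸_; _^_)
open import Data.List using (List; []; _∷_; _++_; replicate; length; take; drop; reverse; map)
open import Data.Integer using (+_)
open import Data.Rational using (ℚ; _/_; 0ℚ; 1ℚ; _+_; _*_; _-_; ∣_∣; _<_)
open import Data.Nat.Combinatorics using (_C_)

-- Bits: false = 0, true = 1.

w : List ℕ → List Bool
w [] = []
w (a ∷ as) = replicate (a ∸ 1) false ++ (true ∷ w as)

-- inverse of w on words that are empty or end with 1
-- (k counts the zeros read so far in the current block)
decodeAux : ℕ → List Bool → List ℕ
decodeAux k [] = []
decodeAux k (false ∷ ws) = decodeAux (suc k) ws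
decodeAux k (true ∷ ws) = suc k ∷ decodeAux 0 ws

decode : List Bool → List ℕ
decode = decodeAux 0

bar : Bool → Bool
bar = not

-- the i-th letter (1-indexed) of a word (default irrelevant outside range)
letter : List Bool → ℕ → Bool
letter [] _ = false
letter (b ∷ bs) zero = false
letter (b ∷ bs) (suc zero) = b
letter (b ∷ bs) (suc (suc i)) = letter bs (suc i)

lam : Bool → Bool → ℕ
lam true  false = 1
lam false false = 2
lam true  true  = 2
lam false true  = 3

-- 1/n as a rational (only used with n ≥ 1)
recip : ℕ → ℚ
recip zero = 0ℚ
recip (suc n) = + 1 / suc n

nat : ℕ → ℚ
nat n = + n / 1

sumTo : ℕ → (ℕ → ℚ) → ℚ
sumTo zero f = 0ℚ
sumTo (suc n) f = sumTo n f + f (suc n)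

H : ℕ → List ℕ → ℚ
H N [] = 1ℚ
H N (c ∷ cs) = sumTo (N ∸ 1) (λ n → recip (n ^ c) * H n cs)

-- φ_m(c1,...,cr) = m^{-c1} Σ_{m > n2 > ... > nr > 0} n2^{-c2} ... nr^{-cr}
-- (only used for non-empty compositions)
φ : ℕ → List ℕ → ℚ
φ m [] = 0ℚ
φ m (c ∷ cs) = recip (m ^ c) * H m cs

ζpartial : List ℕ → ℕ → ℚ
ζpartial a N = H (suc N) a

ψ : ℕ → List ℕ → ℚ
ψ m a = sumTo (length ε ∸ 1) term
  where
  ε : List Bool
  ε = w a
  term : ℕ → ℚ
  term i = (nat (lam (letter ε i) (letter ε (suc i))) * φ m (decode (drop i ε)))
           * φ m (decode (reverse (map bar (take i ε))))

seriesPartial : List ℕ → ℕ → ℚ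
seriesPartial a N = sumTo N (λ m → ψ m a * recip ((2 ℕ.* m) C m))

{-# OPTIONS --safe #-}
-- Write Φ w n for φ_n of the composition with binary word w, and conn n m = n! m! / (n + m)!.  For a splitting of the
-- word of a into A_i (the last k − i letters) and B_i (the first i letters, reversed and complemented), consider the
-- connected sum of Φ A_i n · Φ B_i m · conn n m over N ≥ n > m.  It is the N-th partial sum of ζ(a) for i = 0 and it
-- vanishes for i = k.  The telescoping relation (conn n m − conn n (m + 1)) / n = conn n (m + 1) / (m + 1) moves one
-- letter from A_i to B_{i+1}; restricted to n > m it leaves only diagonal terms n = m, where conn n n = 1 / C(2n, n):
-- letter 0 produces 2 diag_{i+1} and letter 1 produces diag_i + diag_{i+1}.  So diag_i receives λ(ε_i, ε_{i+1}) in total.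
-- Letter 1 also produces a truncation error, bounded by a constant times rate N = Π_{j ≤ N} (1 + 1/(2j)) / (N + 1),
-- which tends to 0 because the product is at most √(2N + 1).
module Submission where

open import Defs
open import Data.Bool using (Bool; true; false)
open import Data.Integer as ℤ using (+_; +[1+_]; -[1+_])
import Data.Integer.Properties as ℤ
open import Data.List using (List; []; _∷_; _++_; replicate; length; take; drop; reverse; map)
open import Data.List.Properties using (++-identityʳ; ++-assoc; unfold-reverse)
open import Data.List.Relation.Unary.All using (All; []; _∷_)
open import Data.Nat as ℕ using (ℕ; zero; suc; z≤n; s≤s)
open import Data.Nat.Combinatorics using (_C_; nCk≡nC[n∸k]; nCk+nC[k+1]≡[n+1]C[k+1]; nC1≡n; k>n⇒nCk≡0)
import Data.Nat.Properties as ℕ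
open import Data.Product using (_×_; _,_; ∃-syntax; proj₁; proj₂)
open import Data.Rational
open import Data.Rational.Properties
open import Data.Rational.Solver using (module +-*-Solver)
import Data.Rational.Unnormalised as ℚᵘ
import Data.Rational.Unnormalised.Properties as ℚᵘ
open import Data.Sum using (inj₁; inj₂)
open import Relation.Binary.PropositionalEquality
open import Relation.Nullary using (contradiction; yes; no)
open +-*-Solver using (solve; _:=_; _:+_; _:*_; _:-_; :-_; con)

-- Arithmetic and order of the rationals `nat n` and `recip n`.

/-toℚᵘ : ∀ n d → toℚᵘ (+ n / suc d) ℚᵘ.≃ ℚᵘ.mkℚᵘ (+ n) d
/-toℚᵘ n d = toℚᵘ-fromℚᵘ (ℚᵘ.mkℚᵘ (+ n) d)

nat-+ : ∀ m n → nat (m ℕ.+ n) ≡ nat m + nat n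
nat-+ m n = toℚᵘ-injective (begin
  toℚᵘ (nat (m ℕ.+ n))          ≈⟨ /-toℚᵘ (m ℕ.+ n) 0 ⟩
  ℚᵘ.mkℚᵘ (+ (m ℕ.+ n)) 0       ≈⟨ ℚᵘ.*≡* (cong (ℤ._* + 1) (sym (cong₂ ℤ._+_ (ℤ.*-identityʳ (+ m)) (ℤ.*-identityʳ (+ n))))) ⟩
  ℚᵘ.mkℚᵘ (+ m) 0 ℚᵘ.+ ℚᵘ.mkℚᵘ (+ n) 0 ≈⟨ ℚᵘ.+-cong (/-toℚᵘ m 0) (/-toℚᵘ n 0) ⟨
  toℚᵘ (nat m) ℚᵘ.+ toℚᵘ (nat n) ≈⟨ toℚᵘ-homo-+ (nat m) (nat n) ⟨
  toℚᵘ (nat m + nat n)          ∎)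
  where open import Relation.Binary.Reasoning.Setoid ℚᵘ.≃-setoid

nat-* : ∀ m n → nat (m ℕ.* n) ≡ nat m * nat n
nat-* zero    n = sym (*-zeroˡ (nat n))
nat-* (suc m) n = begin
  nat (n ℕ.+ m ℕ.* n)   ≡⟨ nat-+ n (m ℕ.* n) ⟩
  nat n + nat (m ℕ.* n) ≡⟨ cong (λ z → nat n + z) (nat-* m n) ⟩
  nat n + nat m * nat n ≡⟨ solve 2 (λ a b → b :+ a :* b := (con 1ℚ :+ a) :* b) refl (nat m) (nat n) ⟩
  (1ℚ + nat m) * nat n  ≡⟨ cong (_* nat n) (nat-+ 1 m) ⟨
  nat (suc m) * nat n   ∎
  where open ≡-Reasoning

nat-recip : ∀ n → nat (suc n) * recip (suc n) ≡ 1ℚ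
nat-recip n = toℚᵘ-injective (begin
  toℚᵘ (nat (suc n) * recip (suc n))  ≈⟨ toℚᵘ-homo-* (nat (suc n)) (recip (suc n)) ⟩
  toℚᵘ (nat (suc n)) ℚᵘ.* toℚᵘ (recip (suc n))  ≈⟨ ℚᵘ.*-cong (/-toℚᵘ (suc n) 0) (/-toℚᵘ 1 n) ⟩
  ℚᵘ.mkℚᵘ (+ suc n) 0 ℚᵘ.* ℚᵘ.mkℚᵘ (+ 1) n      ≈⟨ ℚᵘ.*≡* (trans (ℤ.*-identityʳ _) (trans (ℤ.*-comm (+ suc n) (+ 1)) (sym (ℤ.*-identityˡ _)))) ⟩
  toℚᵘ 1ℚ ∎)
  where open import Relation.Binary.Reasoning.Setoid ℚᵘ.≃-setoid

diff⇒≤ : ∀ {p q} d → 0ℚ ≤ d → p + d ≡ q → p ≤ q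
diff⇒≤ {p} {q} d 0≤d eq = begin
  p      ≡⟨ +-identityʳ p ⟨
  p + 0ℚ ≤⟨ +-monoʳ-≤ p 0≤d ⟩
  p + d  ≡⟨ eq ⟩
  q      ∎
  where open ≤-Reasoning

≤⇒0≤diff : ∀ {p q} → p ≤ q → 0ℚ ≤ q - p
≤⇒0≤diff {p} {q} p≤q = subst (_≤ q - p) (+-inverseʳ p) (+-monoˡ-≤ (- p) p≤q)

0≤+ : ∀ {p q} → 0ℚ ≤ p → 0ℚ ≤ q → 0ℚ ≤ p + q
0≤+ = +-mono-≤

*-mono-≤ : ∀ {p q r s} → 0ℚ ≤ p → 0ℚ ≤ s → p ≤ q → r ≤ s → p * r ≤ q * s
*-mono-≤ {p} {q} {r} {s} 0≤p 0≤s p≤q r≤s =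
  ≤-trans (*-monoˡ-≤-nonNeg p {{nonNegative 0≤p}} r≤s) (*-monoʳ-≤-nonNeg s {{nonNegative 0≤s}} p≤q)

0≤* : ∀ {p q} → 0ℚ ≤ p → 0ℚ ≤ q → 0ℚ ≤ p * q
0≤* 0≤p 0≤q = *-mono-≤ ≤-refl 0≤q 0≤p 0≤q

-- c is the multiplier with l − r = c (q − p) as polynomials; the last hypothesis is then within reach of the ring solver.
≡-modulo : ∀ {l r p q} c → p ≡ q → l + c * p ≡ r + c * q → l ≡ r
≡-modulo {l} {r} {p} c refl eq = begin
  l                     ≡⟨ cancel l (c * p) ⟩
  (l + c * p) - c * p   ≡⟨ cong (_- c * p) eq ⟩
  (r + c * p) - c * p   ≡⟨ cancel r (c * p) ⟨
  r                     ∎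
  where
  open ≡-Reasoning
  cancel : ∀ x y → x ≡ (x + y) - y
  cancel = solve 2 (λ x y → x := (x :+ y) :- y) refl

0≤nat : ∀ n → 0ℚ ≤ nat n
0≤nat n = nonNegative⁻¹ (nat n) {{normalize-nonNeg n 1}}

0≤recip : ∀ n → 0ℚ ≤ recip n
0≤recip zero    = ≤-refl
0≤recip (suc n) = nonNegative⁻¹ (recip (suc n)) {{normalize-nonNeg 1 (suc n)}}

nat-suc : ∀ n → nat (suc n) ≡ 1ℚ + nat n
nat-suc n = nat-+ 1 n

nat-mono-≤ : ∀ {m n} → m ℕ.≤ n → nat m ≤ nat n
nat-mono-≤ {m} m≤n with k , refl ← ℕ.m≤n⇒∃[o]m+o≡n m≤n = diff⇒≤ (nat k) (0≤nat k) (sym (nat-+ m k))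

recip≤1 : ∀ n → recip (suc n) ≤ 1ℚ
recip≤1 n = diff⇒≤ (nat n * recip (suc n)) (0≤* (0≤nat n) (0≤recip (suc n)))
  (begin
    recip (suc n) + nat n * recip (suc n)
      ≡⟨ solve 2 (λ r m → r :+ m :* r := (con 1ℚ :+ m) :* r) refl (recip (suc n)) (nat n) ⟩
    (1ℚ + nat n) * recip (suc n)          ≡⟨ cong (_* recip (suc n)) (nat-suc n) ⟨
    nat (suc n) * recip (suc n)           ≡⟨ nat-recip n ⟩
    1ℚ                                    ∎)
  where open ≡-Reasoning

inverse-unique : ∀ {p q} a → a * p ≡ 1ℚ → a * q ≡ 1ℚ → p ≡ q
inverse-unique {p} {q} a ap≡1 aq≡1 = begin
  p           ≡⟨ *-identityʳ p ⟨
  p * 1ℚ      ≡⟨ cong (p *_) aq≡1 ⟨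
  p * (a * q) ≡⟨ solve 3 (λ p a q → p :* (a :* q) := (a :* p) :* q) refl p a q ⟩
  (a * p) * q ≡⟨ cong (_* q) ap≡1 ⟩
  1ℚ * q      ≡⟨ *-identityˡ q ⟩
  q           ∎
  where open ≡-Reasoning

recip-* : ∀ m n → recip (suc m ℕ.* suc n) ≡ recip (suc m) * recip (suc n)
recip-* m n = inverse-unique (nat (suc m ℕ.* suc n)) (nat-recip (n ℕ.+ m ℕ.* suc n)) (begin
  nat (suc m ℕ.* suc n) * (r * s)     ≡⟨ cong (_* (r * s)) (nat-* (suc m) (suc n)) ⟩
  nat (suc m) * nat (suc n) * (r * s)
    ≡⟨ solve 4 (λ x y r s → x :* y :* (r :* s) := (x :* r) :* (y :* s)) refl (nat (suc m)) (nat (suc n)) r s ⟩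
  (nat (suc m) * r) * (nat (suc n) * s) ≡⟨ cong₂ _*_ (nat-recip m) (nat-recip n) ⟩
  1ℚ                                  ∎)
  where
  open ≡-Reasoning
  r = recip (suc m)
  s = recip (suc n)

-- Binomial coefficients and the connecting factor.

absorption : ∀ n k → suc k ℕ.* (suc n C suc k) ≡ suc n ℕ.* (n C k)
absorption zero zero = refl
absorption zero (suc k) = trans (cong (suc (suc k) ℕ.*_) (k>n⇒nCk≡0 {1} {suc (suc k)} (s≤s (s≤s z≤n)))) (trans (ℕ.*-zeroʳ (suc (suc k))) (sym (cong (1 ℕ.*_) (k>n⇒nCk≡0 {0} {suc k} (s≤s z≤n)))))
absorption n@(suc _) zero = trans (ℕ.*-identityˡ (suc n C 1)) (trans (nC1≡n (suc n)) (sym (ℕ.*-identityʳ (suc n))))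
-- Pascal's rule reduces the claim to its instances for n′ at k′ and at k.
absorption n@(suc n′) k@(suc k′) = begin
  suc k ℕ.* (suc n C suc k)                        ≡⟨ cong (suc k ℕ.*_) (nCk+nC[k+1]≡[n+1]C[k+1] n k) ⟨
  suc k ℕ.* (n C k ℕ.+ n C suc k)                  ≡⟨ ℕ.*-distribˡ-+ (suc k) (n C k) (n C suc k) ⟩
  n C k ℕ.+ k ℕ.* (n C k) ℕ.+ suc k ℕ.* (n C suc k)
    ≡⟨ cong₂ (λ x y → n C k ℕ.+ x ℕ.+ y) (absorption n′ k′) (absorption n′ k) ⟩
  n C k ℕ.+ n ℕ.* (n′ C k′) ℕ.+ n ℕ.* (n′ C k)      ≡⟨ ℕ.+-assoc (n C k) _ _ ⟩
  n C k ℕ.+ (n ℕ.* (n′ C k′) ℕ.+ n ℕ.* (n′ C k))    ≡⟨ cong (n C k ℕ.+_) (ℕ.*-distribˡ-+ n (n′ C k′) (n′ C k)) ⟨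
  n C k ℕ.+ n ℕ.* (n′ C k′ ℕ.+ n′ C k)
    ≡⟨ cong (λ x → n C k ℕ.+ n ℕ.* x) (nCk+nC[k+1]≡[n+1]C[k+1] n′ k′) ⟩
  suc n ℕ.* (n C k)                                ∎
  where open ≡-Reasoning

conn : ℕ → ℕ → ℚ
conn n m = recip ((n ℕ.+ m) C m)

conn-sym : ∀ n m → conn n m ≡ conn m n
conn-sym n m = cong recip (begin
  (n ℕ.+ m) C m             ≡⟨ nCk≡nC[n∸k] (ℕ.m≤n+m m n) ⟩
  (n ℕ.+ m) C (n ℕ.+ m ℕ.∸ m) ≡⟨ cong₂ _C_ (ℕ.+-comm n m) (ℕ.m+n∸n≡m n m) ⟩
  (m ℕ.+ n) C n             ∎)
  where open ≡-Reasoning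

absorption-+ : ∀ n m → suc m ℕ.* ((n ℕ.+ suc m) C suc m) ≡ (n ℕ.+ suc m) ℕ.* ((n ℕ.+ m) C m)
absorption-+ n m rewrite ℕ.+-suc n m = absorption (n ℕ.+ m) m

-- Since `recip` is 0 at 0, `conn` is a true inverse only where the binomial is nonzero. Were the
-- next binomial 0, absorption would make a product of two nonzero factors vanish.
[n+m]Cm≢0 : ∀ n m → ∃[ k ] (n ℕ.+ m) C m ≡ suc k
[n+m]Cm≢0 n zero = 0 , refl
[n+m]Cm≢0 n (suc m) with (n ℕ.+ suc m) C suc m in eq
... | suc k = k , refl
... | zero with k , eq′ ← [n+m]Cm≢0 n m = contradiction
  (trans (sym (absorption-+ n m)) (trans (cong (suc m ℕ.*_) eq) (ℕ.*-zeroʳ (suc m))))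
  λ p → contradiction (trans (sym (cong₂ ℕ._*_ (ℕ.+-suc n m) eq′)) p) λ ()

conn-inverse : ∀ n m → nat ((n ℕ.+ m) C m) * conn n m ≡ 1ℚ
conn-inverse n m with k , eq ← [n+m]Cm≢0 n m rewrite eq = nat-recip k

conn-ratio : ∀ n m → nat (suc m) * conn n m ≡ nat (n ℕ.+ suc m) * conn n (suc m)
conn-ratio n m = begin
  x * conn n m                       ≡⟨ *-identityʳ _ ⟨
  x * conn n m * 1ℚ                  ≡⟨ cong (x * conn n m *_) (conn-inverse n (suc m)) ⟨
  x * conn n m * (X * conn n (suc m))
    ≡⟨ solve 4 (λ x y X z → x :* y :* (X :* z) := (x :* X) :* y :* z) refl x (conn n m) X (conn n (suc m)) ⟩
  (x * X) * conn n m * conn n (suc m)   ≡⟨ cong (λ t → t * conn n m * conn n (suc m)) absorb ⟩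
  (y * Y) * conn n m * conn n (suc m)
    ≡⟨ solve 4 (λ y Y p q → y :* Y :* p :* q := (Y :* p) :* (y :* q)) refl y Y (conn n m) (conn n (suc m)) ⟩
  (Y * conn n m) * (y * conn n (suc m)) ≡⟨ cong (_* (y * conn n (suc m))) (conn-inverse n m) ⟩
  1ℚ * (y * conn n (suc m))          ≡⟨ *-identityˡ _ ⟩
  y * conn n (suc m)                 ∎
  where
  open ≡-Reasoning
  x = nat (suc m)
  y = nat (n ℕ.+ suc m)
  X = nat ((n ℕ.+ suc m) C suc m)
  Y = nat ((n ℕ.+ m) C m)
  absorb : x * X ≡ y * Y
  absorb = trans (sym (nat-* (suc m) ((n ℕ.+ suc m) C suc m))) (trans (cong nat (absorption-+ n m)) (nat-* (n ℕ.+ suc m) ((n ℕ.+ m) C m)))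

-- Left undivided by n, so that it covers n = 0 and also shows that `conn n m` does not increase
-- with m.
conn-diff : ∀ n m → conn n m - conn n (suc m) ≡ nat n * (recip (suc m) * conn n (suc m))
conn-diff n m = ≡-modulo (p - q) (nat-recip m) (≡-modulo (- r) ratio
  (solve 5 (λ p q r x n → (p :- q :+ (p :- q) :* (x :* r)) :+ (:- r) :* (x :* p)
       := (n :* (r :* q) :+ (p :- q) :* con 1ℚ) :+ (:- r) :* ((n :+ x) :* q)) refl p q r x (nat n)))
  where
  p = conn n m
  q = conn n (suc m)
  r = recip (suc m)
  x = nat (suc m)
  ratio : x * p ≡ (nat n + x) * q
  ratio = trans (conn-ratio n m) (cong (_* q) (nat-+ n (suc m)))

conn-transport : ∀ n m → recip (suc n) * (conn (suc n) m - conn (suc n) (suc m)) ≡ recip (suc m) * conn (suc n) (suc m)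
conn-transport n m = ≡-modulo (- (recip (suc m) * q)) (nat-recip n) (≡-modulo (- r) (conn-diff (suc n) m)
  (solve 5 (λ r s p q x → (r :* (p :- q) :+ (:- (s :* q)) :* (x :* r)) :+ (:- r) :* (p :- q)
     := (s :* q :+ (:- (s :* q)) :* con 1ℚ) :+ (:- r) :* (x :* (s :* q)))
     refl r (recip (suc m)) (conn (suc n) m) q (nat (suc n))))
  where
  r = recip (suc n)
  q = conn (suc n) (suc m)

-- Finite sums.

sumTo-cong : ∀ {g h} n → (∀ i → g (suc i) ≡ h (suc i)) → sumTo n g ≡ sumTo n h
sumTo-cong zero    eq = refl
sumTo-cong (suc n) eq = cong₂ _+_ (sumTo-cong n eq) (eq n)

sumTo-+ : ∀ n g h → sumTo n (λ i → g i + h i) ≡ sumTo n g + sumTo n h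
sumTo-+ zero    g h = refl
sumTo-+ (suc n) g h = trans (cong (_+ (g (suc n) + h (suc n))) (sumTo-+ n g h))
  (solve 4 (λ a b c d → (a :+ b) :+ (c :+ d) := (a :+ c) :+ (b :+ d))
      refl (sumTo n g) (sumTo n h) (g (suc n)) (h (suc n)))

sumTo-* : ∀ n c g → sumTo n (λ i → c * g i) ≡ c * sumTo n g
sumTo-* zero    c g = sym (*-zeroʳ c)
sumTo-* (suc n) c g = trans (cong (_+ c * g (suc n)) (sumTo-* n c g)) (sym (*-distribˡ-+ c (sumTo n g) (g (suc n))))

sumTo-suc : ∀ n g → sumTo (suc n) g ≡ g 1 + sumTo n (λ i → g (suc i))
sumTo-suc zero    g = +-comm 0ℚ (g 1)
sumTo-suc (suc n) g = trans (cong (_+ g (suc (suc n))) (sumTo-suc n g)) (+-assoc (g 1) (sumTo n (λ i → g (suc i))) (g (suc (suc n))))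

sumTo-mono-≤ : ∀ {g h} n → (∀ i → g (suc i) ≤ h (suc i)) → sumTo n g ≤ sumTo n h
sumTo-mono-≤ zero    le = ≤-refl
sumTo-mono-≤ (suc n) le = +-mono-≤ (sumTo-mono-≤ n le) (le n)

-- Sums attached to binary words and the transport of letters between them.

sumBelow : ℕ → (ℕ → ℚ) → ℚ
sumBelow zero    g = 0ℚ
sumBelow (suc n) g = sumBelow n g + g n

sumBelow-suc : ∀ n g → sumBelow (suc n) g ≡ g 0 + sumTo n g
sumBelow-suc zero    g = +-comm 0ℚ (g 0)
sumBelow-suc (suc n) g = trans (cong (_+ g (suc n)) (sumBelow-suc n g)) (+-assoc (g 0) (sumTo n g) (g (suc n)))

-- The empty word is the unit mass at 0, so that the sum defining Φ (true ∷ w) may start at 0 for every w;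
-- at positive arguments Φ w agrees with φ only if w is empty or ends with 1.
Φ : List Bool → ℕ → ℚ
Φ []          zero    = 1ℚ
Φ []          (suc n) = 0ℚ
Φ (b ∷ w)     zero    = 0ℚ
Φ (false ∷ w) (suc n) = recip (suc n) * Φ w (suc n)
Φ (true ∷ w)  (suc n) = recip (suc n) * sumBelow (suc n) (Φ w)

-- The cut-off p is separate from n, so that inductions on p run at fixed n and `rem` can take p = n
-- + 1.
inner : List Bool → ℕ → ℕ → ℚ
inner B n p = sumBelow p (λ m → Φ B m * conn n m)

above diag : List Bool → List Bool → ℕ → ℚ
above A B N = sumTo N (λ n → Φ A n * inner B n n)
diag A B N = sumTo N (λ n → Φ A n * Φ B n * conn n n)

-- Summation by parts in m. The telescoping relation, weighted by the partial sums of `Φ B`, builds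
-- the terms of `true ∷ B`; the last term is the boundary term at m = q.
inner-transport : ∀ B n q → recip (suc n) * inner B (suc n) (suc q)
  ≡ inner (true ∷ B) (suc n) (suc q) + recip (suc n) * conn (suc n) q * sumBelow (suc q) (Φ B)
inner-transport B n zero = solve 3 (λ r b x → r :* (con 0ℚ :+ b :* x) := con 0ℚ :+ con 0ℚ :* x :+ r :* x :* (con 0ℚ :+ b)) refl
  (recip (suc n)) (Φ B 0) (conn (suc n) 0)
inner-transport B n (suc q) = ≡-modulo (- 1ℚ) (inner-transport B n q) (≡-modulo (- G) (conn-transport n q)
  (solve 8 (λ r I b x′ J s x G →
     ((r :* (I :+ b :* x′)) :+ con (- 1ℚ) :* (r :* I)) :+ (:- G) :* (r :* (x :- x′))
     := ((J :+ s :* G :* x′ :+ r :* x′ :* (G :+ b)) :+ con (- 1ℚ) :* (J :+ r :* x :* G)) :+ (:- G) :* (s :* x′))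
     refl (recip (suc n)) (inner B (suc n) (suc q)) (Φ B (suc q)) (conn (suc n) (suc q)) (inner (true ∷ B) (suc n) (suc q)) (recip (suc q)) (conn (suc n) q) G))
  where G = sumBelow (suc q) (Φ B)

2ℚ : ℚ
2ℚ = nat 2

-- The case q = n: the telescoping relation gives `conn (suc n) n` = 2 `conn (suc n) (suc n)`, so
-- the boundary term is twice a diagonal term.
inner-false : ∀ B n → recip (suc n) * inner B (suc n) (suc n)
  ≡ inner (true ∷ B) (suc n) (suc n) + 2ℚ * (Φ (true ∷ B) (suc n) * conn (suc n) (suc n))
inner-false B n = ≡-modulo (- 1ℚ) (inner-transport B n n) (≡-modulo (- G) (conn-transport n n)
  (solve 6 (λ r I J x x′ G → (r :* I :+ con (- 1ℚ) :* (r :* I)) :+ (:- G) :* (r :* (x :- x′))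
     := ((J :+ con 2ℚ :* (r :* G :* x′)) :+ con (- 1ℚ) :* (J :+ r :* x :* G)) :+ (:- G) :* (r :* x′))
     refl (recip (suc n)) (inner B (suc n) (suc n)) (inner (true ∷ B) (suc n) (suc n)) (conn (suc n) n) (conn (suc n) (suc n)) G))
  where G = sumBelow (suc n) (Φ B)

-- Exact for every N, since the letter 0 carries no summation in n that the truncation could cut. B
-- may be empty.
above-false : ∀ A B N → above (false ∷ A) B N ≡ above A (true ∷ B) N + 2ℚ * diag A (true ∷ B) N
above-false A B N = trans (sumTo-cong N term) (trans (sumTo-+ N g (λ n → 2ℚ * h n)) (cong (λ z → sumTo N g + z) (sumTo-* N 2ℚ h)))
  where
  g h : ℕ → ℚ
  g n = Φ A n * inner (true ∷ B) n n
  h n = Φ A n * Φ (true ∷ B) n * conn n n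
  term : ∀ n → Φ (false ∷ A) (suc n) * inner B (suc n) (suc n) ≡ g (suc n) + 2ℚ * h (suc n)
  term n = ≡-modulo (- Φ A (suc n)) (inner-false B n)
    (solve 6 (λ r a I J b x → r :* a :* I :+ (:- a) :* (r :* I) := (a :* J :+ con 2ℚ :* (a :* b :* x)) :+ (:- a) :* (J :+ con 2ℚ :* (b :* x)))
      refl (recip (suc n)) (Φ A (suc n)) (inner B (suc n) (suc n)) (inner (true ∷ B) (suc n) (suc n)) (Φ (true ∷ B) (suc n)) (conn (suc n) (suc n)))

-- What the truncation n ≤ N loses when a letter 1 is moved.
rem : List Bool → List Bool → ℕ → ℚ
rem A B N = sumBelow (suc N) (Φ A) * inner B N (suc N)

conn-transportˡ : ∀ n m → recip (suc m) * (conn n (suc m) - conn (suc n) (suc m)) ≡ recip (suc n) * conn (suc n) (suc m)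
conn-transportˡ n m rewrite conn-sym n (suc m) | conn-sym (suc n) (suc m) = conn-transport m n

-- The telescoping relation in n, applied term by term; the letter 0 supplies its factor 1/m. The
-- second word is non-empty because the unit mass of `Φ []` at 0 would add a term on the right only.
inner-shift : ∀ b B n q → inner (false ∷ b ∷ B) n q
  ≡ inner (false ∷ b ∷ B) (suc n) q + recip (suc n) * inner (b ∷ B) (suc n) q
inner-shift b B n zero = solve 1 (λ r → con 0ℚ := con 0ℚ :+ r :* con 0ℚ) refl (recip (suc n))
inner-shift b B n (suc zero) = solve 3 (λ r x y → con 0ℚ :+ con 0ℚ :* x
    := con 0ℚ :+ con 0ℚ :* y :+ r :* (con 0ℚ :+ con 0ℚ :* y))
    refl (recip (suc n)) (conn n 0) (conn (suc n) 0)
inner-shift b B n (suc (suc q)) = ≡-modulo (- 1ℚ) (inner-shift b B n (suc q)) (≡-modulo (- β) (conn-transportˡ n q)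
  (solve 8 (λ I s β x J x′ r K →
     ((I :+ s :* β :* x) :+ con (- 1ℚ) :* I) :+ (:- β) :* (s :* (x :- x′))
     := ((J :+ s :* β :* x′ :+ r :* (K :+ β :* x′)) :+ con (- 1ℚ) :* (J :+ r :* K)) :+ (:- β) :* (r :* x′))
     refl (inner (false ∷ b ∷ B) n (suc q)) (recip (suc q)) β (conn n (suc q)) (inner (false ∷ b ∷ B) (suc n) (suc q)) (conn (suc n) (suc q))
       (recip (suc n)) (inner (b ∷ B) (suc n) (suc q))))
  where β = Φ (b ∷ B) (suc q)

-- Summation by parts in n, with `rem` as boundary term. The two diagonals appear because `rem` sums
-- over m ≤ n whereas `above` sums over m < n.
above-true : ∀ A b B N → above (true ∷ A) (b ∷ B) N + rem A (false ∷ b ∷ B) N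
  ≡ above A (false ∷ b ∷ B) N + diag (true ∷ A) (b ∷ B) N + diag A (false ∷ b ∷ B) N
above-true A b B zero = solve 2 (λ a x → con 0ℚ :+ (con 0ℚ :+ a) :* (con 0ℚ :+ con 0ℚ :* x)
    := con 0ℚ :+ con 0ℚ :+ con 0ℚ)
    refl (Φ A 0) (conn 0 0)
-- The increment of `rem` is (G + a)(J′ + r β x) - G J. Its part a J′ is the new term of `above`,
-- the products with r β x are the new diagonal terms, and `inner-shift` times G removes G J′ - G J.
above-true A b B (suc n) = ≡-modulo (- 1ℚ) (above-true A b B n) (≡-modulo G (inner-shift b B n (suc n))
  (solve 12 (λ S₁ r G I a J′ β x J S₂ D₁ D₂ →
     ((S₁ :+ r :* G :* I :+ (G :+ a) :* (J′ :+ r :* β :* x)) :+ con (- 1ℚ) :* (S₁ :+ G :* J)) :+ G :* J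
     := (((S₂ :+ a :* J′) :+ (D₁ :+ r :* G :* β :* x) :+ (D₂ :+ a :* (r :* β) :* x)) :+ con (- 1ℚ) :* (S₂ :+ D₁ :+ D₂)) :+ G :* (J′ :+ r :* I))
     refl (above (true ∷ A) (b ∷ B) n) (recip (suc n)) G (inner (b ∷ B) (suc n) (suc n)) (Φ A (suc n)) (inner (false ∷ b ∷ B) (suc n) (suc n))
       (Φ (b ∷ B) (suc n)) (conn (suc n) (suc n)) (inner (false ∷ b ∷ B) n (suc n)) (above A (false ∷ b ∷ B) n) (diag (true ∷ A) (b ∷ B) n) (diag A (false ∷ b ∷ B) n)))
  where G = sumBelow (suc n) (Φ A)

-- The comparison sequence `rate`.

-- The factor ½ makes prod satisfy prod (n + 1) − prod n = prod n / (2 (n + 1)), so each letter 1 of a word costs only a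
-- factor 2 in the growth of the partial sums of Φ, while the growth stays below the square root.
prod : ℕ → ℚ
prod zero    = 1ℚ
prod (suc n) = prod n + ½ * (recip (suc n) * prod n)

rate : ℕ → ℚ
rate n = recip (suc n) * prod n

0≤½ : 0ℚ ≤ ½
0≤½ = nonNegative⁻¹ ½

0≤2 : 0ℚ ≤ 2ℚ
0≤2 = 0≤nat 2

1≤prod : ∀ n → 1ℚ ≤ prod n
0≤prod : ∀ n → 0ℚ ≤ prod n
1≤prod zero = ≤-refl
1≤prod (suc n) = ≤-trans (1≤prod n) (diff⇒≤ _ (0≤* 0≤½ (0≤* (0≤recip (suc n)) (0≤prod n))) refl)
0≤prod n = ≤-trans (0≤nat 1) (1≤prod n)

0≤rate : ∀ n → 0ℚ ≤ rate n
0≤rate n = 0≤* (0≤recip (suc n)) (0≤prod n)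

-- Square-root growth stated through squares. With r = 1/(n + 1), the product (2n + 1)(1 + r/2)²
-- falls short of 2n + 3 by exactly r/2 + r²/4.
prod²≤ : ∀ n → prod n * prod n ≤ nat n + nat (suc n)
prod²≤ zero = ≤-refl
prod²≤ (suc n) = begin
  prod (suc n) * prod (suc n)
    ≡⟨ solve 2 (λ p r → (p :+ con ½ :* (r :* p)) :* (p :+ con ½ :* (r :* p))
        := (p :* p) :* ((con 1ℚ :+ con ½ :* r) :* (con 1ℚ :+ con ½ :* r)))
        refl p r ⟩
  (p * p) * ((1ℚ + ½ * r) * (1ℚ + ½ * r)) ≤⟨ *-monoʳ-≤-nonNeg _ {{nonNegative (0≤* 0≤1+ 0≤1+)}} (prod²≤ n) ⟩
  (nat n + nat (suc n)) * ((1ℚ + ½ * r) * (1ℚ + ½ * r))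
    ≤⟨ diff⇒≤ (½ * r + ½ * ½ * (r * r)) (0≤+ (0≤* 0≤½ 0≤r) (0≤* (0≤* 0≤½ 0≤½) (0≤* 0≤r 0≤r))) identity ⟩
  nat (suc n) + nat (suc (suc n)) ∎
  where
  open ≤-Reasoning
  p = prod n
  r = recip (suc n)
  0≤r = 0≤recip (suc n)
  0≤1+ : 0ℚ ≤ 1ℚ + ½ * r
  0≤1+ = 0≤+ (0≤nat 1) (0≤* 0≤½ 0≤r)
  identity : (nat n + nat (suc n)) * ((1ℚ + ½ * r) * (1ℚ + ½ * r)) + (½ * r + ½ * ½ * (r * r)) ≡ nat (suc n) + nat (suc (suc n))
  identity rewrite nat-suc (suc n) = ≡-modulo (- (2ℚ + ½ * r)) (nat-recip n) (≡-modulo ((1ℚ + ½ * r) * (1ℚ + ½ * r)) (nat-suc n)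
    (solve 3 (λ m x r →
      let k = (con 1ℚ :+ con ½ :* r) :* (con 1ℚ :+ con ½ :* r) in
      ((m :+ x) :* k :+ (con ½ :* r :+ con ½ :* con ½ :* (r :* r)) :+ (:- (con 2ℚ :+ con ½ :* r)) :* (x :* r)) :+ k :* x
      := ((x :+ (con 1ℚ :+ x)) :+ (:- (con 2ℚ :+ con ½ :* r)) :* con 1ℚ) :+ k :* (con 1ℚ :+ m))
      refl (nat n) (nat (suc n)) r))

rate²≤ : ∀ n → rate n * rate n ≤ 2ℚ * recip (suc n)
rate²≤ n = begin
  rate n * rate n              ≡⟨ solve 2 (λ r p → (r :* p) :* (r :* p) := (r :* r) :* (p :* p)) refl r (prod n) ⟩
  (r * r) * (prod n * prod n)
    ≤⟨ *-monoˡ-≤-nonNeg (r * r) {{nonNegative (0≤* 0≤r 0≤r)}} (≤-trans (prod²≤ n) (+-monoˡ-≤ x (nat-mono-≤ (ℕ.n≤1+n n)))) ⟩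
  (r * r) * (x + x)      ≡⟨ solve 2 (λ r x → (r :* r) :* (x :+ x) := (con 2ℚ :* r) :* (x :* r)) refl r x ⟩
  (2ℚ * r) * (x * r)     ≡⟨ cong ((2ℚ * r) *_) (nat-recip n) ⟩
  (2ℚ * r) * 1ℚ          ≡⟨ *-identityʳ (2ℚ * r) ⟩
  2ℚ * r                 ∎
  where
  open ≤-Reasoning
  r = recip (suc n)
  x = nat (suc n)
  0≤r = 0≤recip (suc n)

-- Growth and tail bounds for `Φ`.

0≤sumBelow : ∀ {g} n → (∀ i → 0ℚ ≤ g i) → 0ℚ ≤ sumBelow n g
0≤sumBelow zero    _   = ≤-refl
0≤sumBelow (suc n) 0≤g = 0≤+ (0≤sumBelow n 0≤g) (0≤g n)

0≤Φ : ∀ w n → 0ℚ ≤ Φ w n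
0≤Φ []          zero    = 0≤nat 1
0≤Φ []          (suc n) = ≤-refl
0≤Φ (b ∷ w)     zero    = ≤-refl
0≤Φ (false ∷ w) (suc n) = 0≤* (0≤recip (suc n)) (0≤Φ w (suc n))
0≤Φ (true ∷ w)  (suc n) = 0≤* (0≤recip (suc n)) (0≤sumBelow (suc n) (0≤Φ w))

bound : List Bool → ℚ
bound []      = 1ℚ
bound (_ ∷ w) = 2ℚ * bound w

0≤bound : ∀ w → 0ℚ ≤ bound w
0≤bound []      = 0≤nat 1
0≤bound (_ ∷ w) = 0≤* 0≤2 (0≤bound w)

bound≤2bound : ∀ w → bound w ≤ 2ℚ * bound w
bound≤2bound w = diff⇒≤ (bound w) (0≤bound w) (solve 1 (λ x → x :+ x := con 2ℚ :* x) refl (bound w))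

recip*≤ : ∀ n {x} → 0ℚ ≤ x → recip (suc n) * x ≤ x
recip*≤ n {x} 0≤x = subst (recip (suc n) * x ≤_) (*-identityˡ x) (*-monoʳ-≤-nonNeg x {{nonNegative 0≤x}} (recip≤1 n))

1≤bound : ∀ w → 1ℚ ≤ bound w
1≤bound []      = ≤-refl
1≤bound (_ ∷ w) = ≤-trans (1≤bound w) (bound≤2bound w)

Φ0≤1 : ∀ w → Φ w 0 ≤ 1ℚ
Φ0≤1 []      = ≤-refl
Φ0≤1 (_ ∷ w) = 0≤nat 1

-- Simultaneous induction: a bound on the terms for w gives one on its partial sums, and a letter 1
-- turns the latter into a bound on the terms of the longer word.
Φ-bound : ∀ w n → Φ w (suc n) ≤ bound w * rate n
sumBelow-Φ-bound : ∀ w n → sumBelow (suc n) (Φ w) ≤ 2ℚ * bound w * prod n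
Φ-bound [] n = 0≤* (0≤nat 1) (0≤rate n)
Φ-bound (false ∷ w) n = begin
  recip (suc n) * Φ w (suc n) ≤⟨ recip*≤ n (0≤Φ w (suc n)) ⟩
  Φ w (suc n)                 ≤⟨ Φ-bound w n ⟩
  bound w * rate n               ≤⟨ *-monoʳ-≤-nonNeg (rate n) {{nonNegative (0≤rate n)}} (bound≤2bound w) ⟩
  2ℚ * bound w * rate n          ∎
  where open ≤-Reasoning
Φ-bound (true ∷ w) n = begin
  recip (suc n) * sumBelow (suc n) (Φ w)
    ≤⟨ *-monoˡ-≤-nonNeg (recip (suc n)) {{nonNegative (0≤recip (suc n))}} (sumBelow-Φ-bound w n) ⟩
  recip (suc n) * (2ℚ * bound w * prod n)
    ≡⟨ solve 3 (λ r b p → r :* (con 2ℚ :* b :* p) := con 2ℚ :* b :* (r :* p))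
        refl (recip (suc n)) (bound w) (prod n) ⟩
  2ℚ * bound w * rate n                     ∎
  where open ≤-Reasoning
sumBelow-Φ-bound w zero = begin
  0ℚ + Φ w 0        ≡⟨ +-identityˡ (Φ w 0) ⟩
  Φ w 0             ≤⟨ Φ0≤1 w ⟩
  1ℚ                ≤⟨ 1≤bound (true ∷ w) ⟩
  2ℚ * bound w      ≡⟨ *-identityʳ (2ℚ * bound w) ⟨
  2ℚ * bound w * 1ℚ ∎
  where open ≤-Reasoning
sumBelow-Φ-bound w (suc n) = begin
  sumBelow (suc n) (Φ w) + Φ w (suc n)  ≤⟨ +-mono-≤ (sumBelow-Φ-bound w n) (Φ-bound w n) ⟩
  2ℚ * bound w * prod n + bound w * rate n
    -- The increment of `prod` is half of `rate n`, so twice `bound w` times it is exactly the bound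
    -- for the new term.
    ≡⟨ solve 3 (λ b p r → con 2ℚ :* b :* p :+ b :* (r :* p) := con 2ℚ :* b :* (p :+ con ½ :* (r :* p)))
        refl (bound w) (prod n) (recip (suc n)) ⟩
  2ℚ * bound w * prod (suc n)              ∎
  where open ≤-Reasoning

recip-diff : ∀ n → recip (suc n) - recip (suc (suc n)) ≡ recip (suc n) * recip (suc (suc n))
recip-diff n = ≡-modulo r next (≡-modulo (- s) (nat-recip n)
  (solve 3 (λ r s x → (r :- s :+ r :* ((con 1ℚ :+ x) :* s)) :+ (:- s) :* (x :* r)
     := (r :* s :+ r :* con 1ℚ) :+ (:- s) :* con 1ℚ) refl r s (nat (suc n))))
  where
  r = recip (suc n)
  s = recip (suc (suc n))
  next : (1ℚ + nat (suc n)) * s ≡ 1ℚ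
  next = trans (cong (_* s) (sym (nat-suc (suc n)))) (nat-recip (suc n))

4ℚ : ℚ
4ℚ = nat 4

-- A form ready to telescope. With r, s the reciprocals of n + 1 and n + 2, r - s = r s makes `rate`
-- drop by r s `prod n` / 2; as r ≤ 2 s, four times `bound w` times this drop dominates the term.
Φ-false-bound : ∀ w n → Φ (false ∷ w) (suc n) + 4ℚ * bound w * rate (suc n) ≤ 4ℚ * bound w * rate n
Φ-false-bound w n = begin
  r * Φ w (suc n) + 4ℚ * b * rate (suc n)
    ≤⟨ +-monoˡ-≤ (4ℚ * b * rate (suc n)) (*-monoˡ-≤-nonNeg r {{nonNegative 0≤r}} (Φ-bound w n)) ⟩
  r * (b * rate n) + 4ℚ * b * rate (suc n)
    ≤⟨ diff⇒≤ (b * (r * p) * (2ℚ * s - r)) (0≤* (0≤* (0≤bound w) (0≤* 0≤r (0≤prod n))) (≤⇒0≤diff r≤2s)) identity ⟩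
  4ℚ * b * rate n ∎
  where
  open ≤-Reasoning
  r = recip (suc n)
  s = recip (suc (suc n))
  b = bound w
  p = prod n
  0≤r = 0≤recip (suc n)
  0≤s = 0≤recip (suc (suc n))
  r≤2s : r ≤ 2ℚ * s
  r≤2s = diff⇒≤ (s - r * s) (≤⇒0≤diff (recip*≤ n 0≤s))
    (≡-modulo (- 1ℚ) (recip-diff n)
      (solve 2 (λ r s → (r :+ (s :- r :* s)) :+ con (- 1ℚ) :* (r :- s) := con 2ℚ :* s :+ con (- 1ℚ) :* (r :* s))
          refl r s))
  identity : r * (b * rate n) + 4ℚ * b * rate (suc n) + b * (r * p) * (2ℚ * s - r) ≡ 4ℚ * b * rate n
  identity = ≡-modulo (4ℚ * b * p) (recip-diff n)
    (solve 4 (λ r s b p → (r :* (b :* (r :* p)) :+ con 4ℚ :* b :* (s :* (p :+ con ½ :* (r :* p))) :+ b :* (r :* p) :* (con 2ℚ :* s :- r)) :+ (con 4ℚ :* b :* p) :* (r :- s)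
       := con 4ℚ :* b :* (r :* p) :+ (con 4ℚ :* b :* p) :* (r :* s)) refl r s b p)

sumTo-Φ-false-decreasing : ∀ w p k → sumTo (k ℕ.+ p) (Φ (false ∷ w)) + 4ℚ * bound w * rate (k ℕ.+ p) ≤ sumTo p (Φ (false ∷ w)) + 4ℚ * bound w * rate p
sumTo-Φ-false-decreasing w p zero    = ≤-refl
sumTo-Φ-false-decreasing w p (suc k) = begin
  sumTo n (Φ (false ∷ w)) + Φ (false ∷ w) (suc n) + 4ℚ * bound w * rate (suc n)
    ≡⟨ +-assoc (sumTo n (Φ (false ∷ w))) (Φ (false ∷ w) (suc n)) (4ℚ * bound w * rate (suc n)) ⟩
  sumTo n (Φ (false ∷ w)) + (Φ (false ∷ w) (suc n) + 4ℚ * bound w * rate (suc n))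
    ≤⟨ +-monoʳ-≤ (sumTo n (Φ (false ∷ w))) (Φ-false-bound w n) ⟩
  sumTo n (Φ (false ∷ w)) + 4ℚ * bound w * rate n                                 ≤⟨ sumTo-Φ-false-decreasing w p k ⟩
  sumTo p (Φ (false ∷ w)) + 4ℚ * bound w * rate p                                 ∎
  where
  open ≤-Reasoning
  n = k ℕ.+ p

sumTo-Φ-false-tail : ∀ w p k → sumTo (k ℕ.+ p) (Φ (false ∷ w)) ≤ sumTo p (Φ (false ∷ w)) + 4ℚ * bound w * rate p
sumTo-Φ-false-tail w p k = ≤-trans
  (diff⇒≤ (4ℚ * bound w * rate (k ℕ.+ p)) (0≤* (0≤* (0≤nat 4) (0≤bound w)) (0≤rate (k ℕ.+ p))) refl)
  (sumTo-Φ-false-decreasing w p k)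

sumTo-Φ-false-bound : ∀ w n → sumTo n (Φ (false ∷ w)) ≤ 4ℚ * bound w
sumTo-Φ-false-bound w n = begin
  sumTo n (Φ (false ∷ w))         ≡⟨ cong (λ k → sumTo k (Φ (false ∷ w))) (ℕ.+-identityʳ n) ⟨
  sumTo (n ℕ.+ 0) (Φ (false ∷ w)) ≤⟨ sumTo-Φ-false-tail w 0 n ⟩
  0ℚ + 4ℚ * bound w * rate 0         ≡⟨ solve 1 (λ x → con 0ℚ :+ x :* con 1ℚ := x) refl (4ℚ * bound w) ⟩
  4ℚ * bound w                    ∎
  where open ≤-Reasoning

0≤conn : ∀ n m → 0ℚ ≤ conn n m
0≤conn n m = 0≤recip ((n ℕ.+ m) C m)

-- `conn n m` does not increase with m and equals 1/(n + 1) at m = 1.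
conn≤recip : ∀ n m → conn n (suc m) ≤ recip (suc n)
conn≤recip n zero = ≤-reflexive (cong recip (trans (nC1≡n (n ℕ.+ 1)) (ℕ.+-comm n 1)))
conn≤recip n (suc m) = ≤-trans (diff⇒≤ (conn n (suc m) - conn n (suc (suc m)))
    (subst (0ℚ ≤_) (sym (conn-diff n (suc m))) (0≤* (0≤nat n) (0≤* (0≤recip (suc (suc m))) (0≤conn n (suc (suc m))))))
    (solve 2 (λ x y → y :+ (x :- y) := x) refl (conn n (suc m)) (conn n (suc (suc m)))))
  (conn≤recip n m)

inner-false-bound : ∀ w n → inner (false ∷ w) n (suc n) ≤ recip (suc n) * (4ℚ * bound w)
inner-false-bound w n = begin
  inner (false ∷ w) n (suc n)                               ≡⟨ sumBelow-suc n (λ m → Φ (false ∷ w) m * conn n m) ⟩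
  0ℚ * conn n 0 + sumTo n (λ m → Φ (false ∷ w) m * conn n m)
    ≡⟨ solve 2 (λ x y → con 0ℚ :* x :+ y := y) refl (conn n 0) (sumTo n (λ m → Φ (false ∷ w) m * conn n m)) ⟩
  sumTo n (λ m → Φ (false ∷ w) m * conn n m)                   ≤⟨ sumTo-mono-≤ n term ⟩
  sumTo n (λ m → recip (suc n) * Φ (false ∷ w) m)           ≡⟨ sumTo-* n (recip (suc n)) (Φ (false ∷ w)) ⟩
  recip (suc n) * sumTo n (Φ (false ∷ w))
    ≤⟨ *-monoˡ-≤-nonNeg (recip (suc n)) {{nonNegative (0≤recip (suc n))}} (sumTo-Φ-false-bound w n) ⟩
  recip (suc n) * (4ℚ * bound w)                            ∎
  where
  open ≤-Reasoning
  term : ∀ m → Φ (false ∷ w) (suc m) * conn n (suc m) ≤ recip (suc n) * Φ (false ∷ w) (suc m)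
  term m = ≤-trans (*-monoˡ-≤-nonNeg (Φ (false ∷ w) (suc m)) {{nonNegative (0≤Φ (false ∷ w) (suc m))}} (conn≤recip n m))
    (≤-reflexive (*-comm (Φ (false ∷ w) (suc m)) (recip (suc n))))

0≤rem : ∀ A B n → 0ℚ ≤ rem A B n
0≤rem A B n = 0≤* (0≤sumBelow (suc n) (0≤Φ A)) (0≤sumBelow (suc n) (λ m → 0≤* (0≤Φ B m) (0≤conn n m)))

-- The sum over A grows at most like `prod n`. The inner sum decays like 1/(n + 1), because a
-- leading 0 keeps the sum over m bounded.
rem-bound : ∀ A w n → rem A (false ∷ w) n ≤ (2ℚ * bound A * (4ℚ * bound w)) * rate n
rem-bound A w n = begin
  rem A (false ∷ w) n
    ≤⟨ *-mono-≤ (0≤sumBelow (suc n) (0≤Φ A)) (0≤* (0≤recip (suc n)) (0≤* (0≤nat 4) (0≤bound w))) (sumBelow-Φ-bound A n) (inner-false-bound w n) ⟩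
  2ℚ * bound A * prod n * (recip (suc n) * (4ℚ * bound w))
    ≡⟨ solve 4 (λ a p r b → a :* p :* (r :* b) := a :* b :* (r :* p))
        refl (2ℚ * bound A) (prod n) (recip (suc n)) (4ℚ * bound w) ⟩
  (2ℚ * bound A * (4ℚ * bound w)) * rate n ∎
  where open ≤-Reasoning

-- Sequences that differ by a null error.

infix 4 _∼_

-- An error of order `rate n` instead of an epsilon statement: composing finitely many steps only
-- adds the constants.
record _∼_ (x y : ℕ → ℚ) : Set where
  constructor bounded-by
  field
    K      : ℚ
    within : ∀ n → ∣ x n - y n ∣ ≤ K * rate n

archimedean : ∀ p q → 0ℚ < q → ∃[ N ] p ≤ nat N * q
archimedean p@(mkℚ (-[1+ n ]) d _) q 0<q = 0 , ≤-trans (nonPositive⁻¹ p) (≤-reflexive (sym (*-zeroˡ q)))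
-- N is the numerator of p times the denominator of q, so N q is n (a + 1), which is at least n and
-- hence at least p.
archimedean p@(mkℚ (+ n) d _) q@(mkℚ +[1+ a ] b _) 0<q = n ℕ.* suc b , toℚᵘ-cancel-≤ (begin
  toℚᵘ p
    ≤⟨ ℚᵘ.*≤* (ℤ.≤-trans (ℤ.≤-reflexive (sym (ℤ.pos-* n (1 ℕ.* suc b)))) (ℤ.≤-trans (ℤ.+≤+ le) (ℤ.≤-reflexive (trans (ℤ.pos-* (n ℕ.* suc b ℕ.* suc a) (suc d)) (cong (ℤ._* + suc d) (ℤ.pos-* (n ℕ.* suc b) (suc a))))))) ⟩
  ℚᵘ.mkℚᵘ (+ (n ℕ.* suc b)) 0 ℚᵘ.* toℚᵘ q ≃⟨ ℚᵘ.*-congʳ {toℚᵘ q} (/-toℚᵘ (n ℕ.* suc b) 0) ⟨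
  toℚᵘ (nat (n ℕ.* suc b)) ℚᵘ.* toℚᵘ q ≃⟨ toℚᵘ-homo-* (nat (n ℕ.* suc b)) q ⟨
  toℚᵘ (nat (n ℕ.* suc b) * q) ∎)
  where
  open ℚᵘ.≤-Reasoning
  le : n ℕ.* (1 ℕ.* suc b) ℕ.≤ n ℕ.* suc b ℕ.* suc a ℕ.* suc d
  le = ℕ.≤-trans (ℕ.≤-reflexive (cong (n ℕ.*_) (ℕ.*-identityˡ (suc b)))) (ℕ.≤-trans (ℕ.m≤m*n _ (suc a)) (ℕ.m≤m*n _ (suc d)))
archimedean p@(mkℚ (+ n) d _) (mkℚ (+ 0) b _) (*<* (ℤ.+<+ ()))
archimedean p@(mkℚ (+ n) d _) (mkℚ -[1+ a ] b _) (*<* ())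

-- Squaring avoids roots: choose N with 2 K² ≤ N δ². If K `rate n` ≥ δ for some n ≥ N, then (n + 1)
-- δ² ≤ 2 K² ≤ n δ², which is absurd.
rate-null : ∀ K δ → 0ℚ < δ → ∃[ N ] ∀ n → N ℕ.≤ n → K * rate n < δ
rate-null K δ 0<δ = N , small
  where
  0≤δ = <⇒≤ 0<δ
  0<δδ : 0ℚ < δ * δ
  0<δδ = positive⁻¹ (δ * δ) {{pos*pos⇒pos δ {{positive 0<δ}} δ {{positive 0<δ}}}}
  0≤square : ∀ k → 0ℚ ≤ k * k
  0≤square k with ≤-total 0ℚ k
  ... | inj₁ 0≤k = 0≤* 0≤k 0≤k
  ... | inj₂ k≤0 = nonNegative⁻¹ (k * k) {{nonPos*nonPos⇒nonPos k {{nonPositive k≤0}} k {{nonPositive k≤0}}}}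
  large : ∃[ N ] 2ℚ * (K * K) ≤ nat N * (δ * δ)
  large = archimedean (2ℚ * (K * K)) (δ * δ) 0<δδ
  N = proj₁ large
  le = proj₂ large
  small : ∀ n → N ℕ.≤ n → K * rate n < δ
  small n N≤n with K * rate n <? δ
  ... | yes lt = lt
  ... | no  ge = contradiction absurd (<-irrefl refl)
    where
    open ≤-Reasoning
    x = nat (suc n)
    δ≤ = ≮⇒≥ ge
    absurd : nat n * (δ * δ) < nat n * (δ * δ)
    absurd = begin-strict
      nat n * (δ * δ) ≡⟨ +-identityˡ (nat n * (δ * δ)) ⟨
      0ℚ + nat n * (δ * δ) <⟨ +-monoˡ-< (nat n * (δ * δ)) 0<δδ ⟩
      δ * δ + nat n * (δ * δ) ≡⟨ solve 2 (λ d m → d :+ m :* d := (con 1ℚ :+ m) :* d) refl (δ * δ) (nat n) ⟩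
      (1ℚ + nat n) * (δ * δ) ≡⟨ cong (_* (δ * δ)) (nat-suc n) ⟨
      x * (δ * δ) ≤⟨ *-monoˡ-≤-nonNeg x {{nonNegative (0≤nat (suc n))}} (*-mono-≤ 0≤δ (≤-trans 0≤δ δ≤) δ≤ δ≤) ⟩
      x * ((K * rate n) * (K * rate n))
        ≡⟨ solve 3 (λ x k rate → x :* ((k :* rate) :* (k :* rate)) := (x :* (k :* k)) :* (rate :* rate))
            refl x K (rate n) ⟩
      (x * (K * K)) * (rate n * rate n)
        ≤⟨ *-monoˡ-≤-nonNeg (x * (K * K)) {{nonNegative (0≤* (0≤nat (suc n)) (0≤square K))}} (rate²≤ n) ⟩
      (x * (K * K)) * (2ℚ * recip (suc n))
        ≡⟨ solve 4 (λ x k t r → (x :* k) :* (t :* r) := (t :* k) :* (x :* r)) refl x (K * K) 2ℚ (recip (suc n)) ⟩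
      (2ℚ * (K * K)) * (x * recip (suc n)) ≡⟨ cong ((2ℚ * (K * K)) *_) (nat-recip n) ⟩
      (2ℚ * (K * K)) * 1ℚ ≡⟨ *-identityʳ (2ℚ * (K * K)) ⟩
      2ℚ * (K * K) ≤⟨ le ⟩
      nat N * (δ * δ) ≤⟨ *-monoʳ-≤-nonNeg (δ * δ) {{nonNegative (<⇒≤ 0<δδ)}} (nat-mono-≤ N≤n) ⟩
      nat n * (δ * δ) ∎

≡⇒∼ : ∀ {x y} → (∀ n → x n ≡ y n) → x ∼ y
≡⇒∼ {x} {y} eq = bounded-by 0ℚ λ n → ≤-reflexive (begin
  ∣ x n - y n ∣ ≡⟨ cong (λ z → ∣ z - y n ∣) (eq n) ⟩
  ∣ y n - y n ∣ ≡⟨ cong ∣_∣ (+-inverseʳ (y n)) ⟩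
  0ℚ            ≡⟨ *-zeroˡ (rate n) ⟨
  0ℚ * rate n      ∎)
  where open ≡-Reasoning

∼-trans : ∀ {x y z} → x ∼ y → y ∼ z → x ∼ z
∼-trans {x} {y} {z} (bounded-by K xy) (bounded-by L yz) = bounded-by (K + L) λ n → begin
  ∣ x n - z n ∣
    ≡⟨ cong ∣_∣ (solve 3 (λ x y z → x :- z := (x :- y) :+ (y :- z)) refl (x n) (y n) (z n)) ⟩
  ∣ (x n - y n) + (y n - z n) ∣     ≤⟨ ∣p+q∣≤∣p∣+∣q∣ (x n - y n) (y n - z n) ⟩
  ∣ x n - y n ∣ + ∣ y n - z n ∣     ≤⟨ +-mono-≤ (xy n) (yz n) ⟩
  K * rate n + L * rate n                 ≡⟨ *-distribʳ-+ (rate n) K L ⟨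
  (K + L) * rate n                     ∎
  where open ≤-Reasoning

∼-+ʳ : ∀ {x y} (z : ℕ → ℚ) → x ∼ y → (λ n → x n + z n) ∼ (λ n → y n + z n)
∼-+ʳ {x} {y} z (bounded-by K xy) = bounded-by K λ n →
  subst (λ t → ∣ t ∣ ≤ K * rate n) (solve 3 (λ x y z → x :- y := (x :+ z) :- (y :+ z)) refl (x n) (y n) (z n)) (xy n)

∼⇒close : ∀ {x y} → x ∼ y → ∀ δ → 0ℚ < δ → ∃[ N ] (∀ n → N ℕ.≤ n → ∣ x n - y n ∣ < δ)
∼⇒close (bounded-by K xy) δ 0<δ with N , small ← rate-null K δ 0<δ = N , λ n N≤n → ≤-<-trans (xy n) (small n N≤n)

-- Transport of the whole word.

-- ψ_m for the splittings still to come: e is the letter moved last, A the word left, B the word collected.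
splits : Bool → List Bool → List Bool → ℕ → ℚ
splits e []       B m = 0ℚ
splits e (e′ ∷ A) B m = nat (lam e e′) * Φ (e′ ∷ A) m * Φ B m + splits e′ A (bar e′ ∷ B) m

central : (ℕ → ℚ) → ℕ → ℚ
central v N = sumTo N (λ m → v m * conn m m)

central-splits : ∀ e e′ A B N → central (splits e (e′ ∷ A) B) N ≡ central (splits e′ A (bar e′ ∷ B)) N + nat (lam e e′) * diag (e′ ∷ A) B N
central-splits e e′ A B N = begin
  central (splits e (e′ ∷ A) B) N                   ≡⟨ sumTo-cong N (λ m → term (suc m)) ⟩
  sumTo N (λ m → g m + l * h m)                ≡⟨ sumTo-+ N g (λ m → l * h m) ⟩
  sumTo N g + sumTo N (λ m → l * h m)          ≡⟨ cong (λ z → sumTo N g + z) (sumTo-* N l h) ⟩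
  sumTo N g + l * sumTo N h                    ∎
  where
  open ≡-Reasoning
  l = nat (lam e e′)
  g h : ℕ → ℚ
  g m = splits e′ A (bar e′ ∷ B) m * conn m m
  h m = Φ (e′ ∷ A) m * Φ B m * conn m m
  term : ∀ m → splits e (e′ ∷ A) B m * conn m m ≡ g m + l * h m
  term m = solve 5 (λ l a b v x → (l :* a :* b :+ v) :* x := v :* x :+ l :* (a :* b :* x))
      refl l (Φ (e′ ∷ A) m) (Φ B m) (splits e′ A (bar e′ ∷ B) m) (conn m m)

sumTo-zero : ∀ N g → (∀ n → g (suc n) ≡ 0ℚ) → sumTo N g ≡ 0ℚ
sumTo-zero zero    g eq = refl
sumTo-zero (suc N) g eq = cong₂ _+_ (sumTo-zero N g eq) (eq N)

-- λ(e, e′) is the share λ(e, 0) left on the diagonal by moving e, plus 1 if the next letter e′ is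
-- 1.
lam-true : ∀ e → nat (lam e true) ≡ nat (lam e false) + 1ℚ
lam-true true  = refl
lam-true false = refl

-- The invariant of the transport: the diagonal term on the left is the share already produced by e,
-- the letter moved last. Once A is empty both sides vanish, as `Φ []` is 0 at positive arguments.
above∼central : ∀ e A b B → (λ N → above A (b ∷ B) N + nat (lam e false) * diag A (b ∷ B) N) ∼ central (splits e A (b ∷ B))
above∼central e [] b B = ≡⇒∼ λ N → begin
  above [] (b ∷ B) N + nat (lam e false) * diag [] (b ∷ B) N
    ≡⟨ cong₂ (λ s d → s + nat (lam e false) * d)
         (sumTo-zero N (λ n → Φ [] n * inner (b ∷ B) n n) (λ n → *-zeroˡ (inner (b ∷ B) (suc n) (suc n))))
         (sumTo-zero N (λ n → Φ [] n * Φ (b ∷ B) n * conn n n) (λ n → solve 2 (λ x y → con 0ℚ :* x :* y := con 0ℚ)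
             refl (Φ (b ∷ B) (suc n)) (conn (suc n) (suc n)))) ⟩
  0ℚ + nat (lam e false) * 0ℚ ≡⟨ solve 1 (λ l → con 0ℚ :+ l :* con 0ℚ := con 0ℚ) refl (nat (lam e false)) ⟩
  0ℚ ≡⟨ sumTo-zero N (λ m → 0ℚ * conn m m) (λ m → *-zeroˡ (conn (suc m) (suc m))) ⟨
  central (splits e [] (b ∷ B)) N ∎
  where open ≡-Reasoning
above∼central e (e′ ∷ A) b B = ∼-trans (step e′)
  (∼-trans (∼-+ʳ (λ N → nat (lam e e′) * diag (e′ ∷ A) (b ∷ B) N) (above∼central e′ A (bar e′) (b ∷ B)))
           (≡⇒∼ λ N → sym (central-splits e e′ A (b ∷ B) N)))
  where
  step : ∀ e′ → (λ N → above (e′ ∷ A) (b ∷ B) N + nat (lam e false) * diag (e′ ∷ A) (b ∷ B) N)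
    ∼ (λ N → (above A (bar e′ ∷ b ∷ B) N + nat (lam e′ false) * diag A (bar e′ ∷ b ∷ B) N) + nat (lam e e′) * diag (e′ ∷ A) (b ∷ B) N)
  -- The coefficient 2 produced by a letter 0 is λ(0, 0), the share passed on to the next stage.
  step false = ≡⇒∼ λ N → cong (_+ nat (lam e false) * diag (false ∷ A) (b ∷ B) N) (above-false A (b ∷ B) N)
  -- One new diagonal raises λ(e, 0) to λ(e, 1), the other is the share λ(1, 0) = 1 passed on; the
  -- discrepancy is exactly `rem`.
  step true = bounded-by (2ℚ * bound A * (4ℚ * bound (b ∷ B))) λ N → ≤-trans (≤-reflexive (error N)) (rem-bound A (b ∷ B) N)
    where
    open ≡-Reasoning
    error : ∀ N → ∣ (above (true ∷ A) (b ∷ B) N + nat (lam e false) * diag (true ∷ A) (b ∷ B) N)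
      - ((above A (false ∷ b ∷ B) N + 1ℚ * diag A (false ∷ b ∷ B) N) + nat (lam e true) * diag (true ∷ A) (b ∷ B) N) ∣ ≡ rem A (false ∷ b ∷ B) N
    error N = begin
      ∣ (s₁ + l * d₁) - ((s₂ + 1ℚ * d₂) + nat (lam e true) * d₁) ∣
        ≡⟨ cong (λ t → ∣ (s₁ + l * d₁) - ((s₂ + 1ℚ * d₂) + t * d₁) ∣) (lam-true e) ⟩
      ∣ (s₁ + l * d₁) - ((s₂ + 1ℚ * d₂) + (l + 1ℚ) * d₁) ∣ ≡⟨ cong ∣_∣ (≡-modulo (- 1ℚ) (above-true A b B N)
          (solve 6 (λ s₁ s₂ d₁ d₂ ε l → ((s₁ :+ l :* d₁) :- ((s₂ :+ con 1ℚ :* d₂) :+ (l :+ con 1ℚ) :* d₁)) :+ con (- 1ℚ) :* (s₁ :+ ε)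
             := (:- ε) :+ con (- 1ℚ) :* (s₂ :+ d₁ :+ d₂)) refl s₁ s₂ d₁ d₂ ε l)) ⟩
      ∣ - ε ∣ ≡⟨ ∣-p∣≡∣p∣ ε ⟩
      ∣ ε ∣ ≡⟨ 0≤p⇒∣p∣≡p (0≤rem A (false ∷ b ∷ B) N) ⟩
      ε ∎
      where
      s₁ = above (true ∷ A) (b ∷ B) N
      s₂ = above A (false ∷ b ∷ B) N
      d₁ = diag (true ∷ A) (b ∷ B) N
      d₂ = diag A (false ∷ b ∷ B) N
      ε = rem A (false ∷ b ∷ B) N
      l = nat (lam e false)

-- From binary words back to compositions.

-- The non-empty tail in `false∷` excludes trailing zeros, which `decodeAux` would silently drop.
data EndsIn1 : List Bool → Set where
  []     : EndsIn1 []
  true∷  : ∀ {w} → EndsIn1 w → EndsIn1 (true ∷ w)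
  false∷ : ∀ {b w} → EndsIn1 (b ∷ w) → EndsIn1 (false ∷ b ∷ w)

EndsIn1-tail : ∀ {b w} → EndsIn1 (b ∷ w) → EndsIn1 w
EndsIn1-tail (true∷ g)  = g
EndsIn1-tail (false∷ g) = g

EndsIn1-∷ : ∀ b′ {b w} → EndsIn1 (b ∷ w) → EndsIn1 (b′ ∷ b ∷ w)
EndsIn1-∷ true  g = true∷ g
EndsIn1-∷ false g = false∷ g

EndsIn1-zeros : ∀ k {w} → EndsIn1 w → EndsIn1 (replicate k false ++ true ∷ w)
EndsIn1-zeros zero          g = true∷ g
EndsIn1-zeros (suc zero)    g = false∷ (true∷ g)
EndsIn1-zeros (suc (suc k)) g = false∷ (EndsIn1-zeros (suc k) g)

EndsIn1-w : ∀ a → EndsIn1 (w a)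
EndsIn1-w []      = []
EndsIn1-w (c ∷ a) = EndsIn1-zeros (c ℕ.∸ 1) (EndsIn1-w a)

decodeAux-nonempty : ∀ k {b w} → EndsIn1 (b ∷ w) → ∃[ c ] ∃[ cs ] decodeAux k (b ∷ w) ≡ c ∷ cs
decodeAux-nonempty k (true∷ g)  = _ , _ , refl
decodeAux-nonempty k (false∷ g) = decodeAux-nonempty (suc k) g

^-nonzero : ∀ m k → ∃[ j ] suc m ℕ.^ k ≡ suc j
^-nonzero m zero = 0 , refl
^-nonzero m (suc k) with j , eq ← ^-nonzero m k rewrite eq = _ , refl

recip-^-suc : ∀ m k → recip (suc m ℕ.^ suc k) ≡ recip (suc m ℕ.^ k) * recip (suc m)
recip-^-suc m k with j , eq ← ^-nonzero m k rewrite eq = trans (recip-* m j) (*-comm (recip (suc m)) (recip (suc j)))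

-- The k zeros already read raise the next exponent by k, hence the extra factor. A letter 1 closes
-- the block and passes to the nested sum, so both statements are proved together.
φ-decodeAux : ∀ k m {w} → EndsIn1 w → φ (suc m) (decodeAux k w) ≡ recip (suc m ℕ.^ k) * Φ w (suc m)
H-decode : ∀ m {w} → EndsIn1 w → H (suc m) (decode w) ≡ sumBelow (suc m) (Φ w)
φ-decodeAux k m [] = sym (*-zeroʳ (recip (suc m ℕ.^ k)))
φ-decodeAux k m {true ∷ w} (true∷ g) = begin
  recip (suc m ℕ.^ suc k) * H (suc m) (decode w) ≡⟨ cong₂ _*_ (recip-^-suc m k) (H-decode m g) ⟩
  recip (suc m ℕ.^ k) * recip (suc m) * sumBelow (suc m) (Φ w)
    ≡⟨ *-assoc (recip (suc m ℕ.^ k)) (recip (suc m)) (sumBelow (suc m) (Φ w)) ⟩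
  recip (suc m ℕ.^ k) * (recip (suc m) * sumBelow (suc m) (Φ w)) ∎
  where open ≡-Reasoning
φ-decodeAux k m {false ∷ w} (false∷ g) = begin
  φ (suc m) (decodeAux (suc k) w) ≡⟨ φ-decodeAux (suc k) m g ⟩
  recip (suc m ℕ.^ suc k) * Φ w (suc m) ≡⟨ cong (_* Φ w (suc m)) (recip-^-suc m k) ⟩
  recip (suc m ℕ.^ k) * recip (suc m) * Φ w (suc m) ≡⟨ *-assoc (recip (suc m ℕ.^ k)) (recip (suc m)) (Φ w (suc m)) ⟩
  recip (suc m ℕ.^ k) * (recip (suc m) * Φ w (suc m)) ∎
  where open ≡-Reasoning
-- The unit mass of `Φ []` at 0 matches the value 1 of `H` on the empty composition.
H-decode m [] = sym (trans (sumBelow-suc m (Φ [])) (cong (λ z → 1ℚ + z) (sumTo-zero m (Φ []) (λ _ → refl))))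
H-decode m {b ∷ w} g with c , cs , eq ← decodeAux-nonempty 0 g = begin
  H (suc m) (decode (b ∷ w))                ≡⟨ cong (H (suc m)) eq ⟩
  sumTo m (λ n → φ n (c ∷ cs))              ≡⟨ cong (λ a → sumTo m (λ n → φ n a)) eq ⟨
  sumTo m (λ n → φ n (decode (b ∷ w)))
    ≡⟨ sumTo-cong m (λ i → trans (φ-decodeAux 0 i g) (*-identityˡ (Φ (b ∷ w) (suc i)))) ⟩
  sumTo m (Φ (b ∷ w))                       ≡⟨ +-identityˡ (sumTo m (Φ (b ∷ w))) ⟨
  0ℚ + sumTo m (Φ (b ∷ w))                  ≡⟨ sumBelow-suc m (Φ (b ∷ w)) ⟨
  sumBelow (suc m) (Φ (b ∷ w))              ∎
  where open ≡-Reasoning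

-- The terms of `ψ` with an accumulator B for the letters already moved; B = [] gives those of `ψ`
-- itself.
summand : ℕ → Bool → List Bool → List Bool → ℕ → ℚ
summand m e A B i = nat (lam (letter (e ∷ A) i) (letter (e ∷ A) (suc i))) * φ m (decode (drop i (e ∷ A)))
  * φ m (decode (reverse (map bar (take i (e ∷ A))) ++ B))

φ-decode : ∀ m {w} → EndsIn1 w → φ (suc m) (decode w) ≡ Φ w (suc m)
φ-decode m {w} g = trans (φ-decodeAux 0 m g) (*-identityˡ (Φ w (suc m)))

-- Passing e to the accumulator lowers the index by one. The right-hand index starts at 1, as
-- `letter` has only a default value at 0.
summand-suc : ∀ m e e′ A B i → summand m e (e′ ∷ A) B (suc (suc i)) ≡ summand m e′ A (bar e ∷ B) (suc i)
summand-suc m e e′ A B i = cong (λ v → nat (lam (letter (e′ ∷ A) (suc i)) (letter (e′ ∷ A) (suc (suc i)))) * φ m (decode (drop (suc i) (e′ ∷ A))) * φ m (decode v))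
  (trans (cong (_++ B) (unfold-reverse (bar e) X)) (++-assoc (reverse X) (bar e ∷ []) B))
  where X = map bar (take (suc i) (e′ ∷ A))

sumTo-summand : ∀ m e A B → EndsIn1 A → EndsIn1 (bar e ∷ B) → sumTo (length A) (summand (suc m) e A B) ≡ splits e A (bar e ∷ B) (suc m)
sumTo-summand m e []       B gA gB = refl
sumTo-summand m e (e′ ∷ A) B gA gB = begin
  sumTo (suc (length A)) (summand (suc m) e (e′ ∷ A) B)
    ≡⟨ sumTo-suc (length A) (summand (suc m) e (e′ ∷ A) B) ⟩
  summand (suc m) e (e′ ∷ A) B 1 + sumTo (length A) (λ i → summand (suc m) e (e′ ∷ A) B (suc i))
    ≡⟨ cong₂ _+_ (cong₂ (λ x y → nat (lam e e′) * x * y) (φ-decode m gA) (φ-decode m gB))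
         (sumTo-cong (length A) (summand-suc (suc m) e e′ A B)) ⟩
  nat (lam e e′) * Φ (e′ ∷ A) (suc m) * Φ (bar e ∷ B) (suc m) + sumTo (length A) (summand (suc m) e′ A (bar e ∷ B))
    ≡⟨ cong (λ z → nat (lam e e′) * Φ (e′ ∷ A) (suc m) * Φ (bar e ∷ B) (suc m) + z)
         (sumTo-summand m e′ A (bar e ∷ B) (EndsIn1-tail gA) (EndsIn1-∷ (bar e′) gB)) ⟩
  splits e (e′ ∷ A) (bar e ∷ B) (suc m) ∎
  where open ≡-Reasoning

decodeAux-zeros : ∀ j k ws → decodeAux j (replicate k false ++ true ∷ ws) ≡ suc (k ℕ.+ j) ∷ decode ws
decodeAux-zeros j zero    ws = refl
decodeAux-zeros j (suc k) ws = trans (decodeAux-zeros (suc j) k ws) (cong (λ i → suc i ∷ decode ws) (ℕ.+-suc k j))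

decode-w : ∀ {a} → All (1 ℕ.≤_) a → decode (w a) ≡ a
decode-w [] = refl
decode-w {suc c ∷ a} (_ ∷ pos) = trans (decodeAux-zeros 0 c (w a)) (cong₂ _∷_ (cong suc (ℕ.+-identityʳ c)) (decode-w pos))

-- Convergence and comparison of the two series.

module _ (c : ℕ) (cs : List ℕ) (pos : All (1 ℕ.≤_) cs) where

  private
    a  = suc (suc c) ∷ cs
    -- As the first entry is at least 2, `w a` computes to `false ∷ w′`.
    w′ = replicate c false ++ true ∷ w cs

  φ-w : ∀ n → φ (suc n) a ≡ Φ (false ∷ w′) (suc n)
  φ-w n = trans (cong (φ (suc n)) (sym (decode-w {a} (s≤s z≤n ∷ pos)))) (φ-decode n (EndsIn1-w a))

  ζpartial-Φ : ∀ N → ζpartial a N ≡ sumTo N (Φ (false ∷ w′))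
  ζpartial-Φ N = sumTo-cong N φ-w

  -- Against the empty word only m = 0 contributes, and `conn n 0` is 1.
  ζpartial-above : ∀ N → ζpartial a N ≡ above (false ∷ w′) [] N
  ζpartial-above N = sumTo-cong N λ n → trans (φ-w n) (trans (sym (*-identityʳ (Φ (false ∷ w′) (suc n)))) (cong (Φ (false ∷ w′) (suc n) *_) (sym (inner-[] n))))
    where
    inner-[] : ∀ n → inner [] (suc n) (suc n) ≡ 1ℚ
    inner-[] n = begin
      inner [] (suc n) (suc n)                             ≡⟨ sumBelow-suc n (λ m → Φ [] m * conn (suc n) m) ⟩
      1ℚ * 1ℚ + sumTo n (λ m → Φ [] m * conn (suc n) m)
        ≡⟨ cong (λ z → 1ℚ * 1ℚ + z) (sumTo-zero n (λ m → Φ [] m * conn (suc n) m) (λ m → *-zeroˡ (conn (suc n) (suc m)))) ⟩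
      1ℚ                                                   ∎
      where open ≡-Reasoning

  ψ-splits : ∀ m → ψ (suc m) a ≡ splits false w′ (true ∷ []) (suc m)
  ψ-splits m = trans (sumTo-cong (length w′) λ i → cong (λ v → nat (lam (letter (false ∷ w′) (suc i)) (letter (false ∷ w′) (suc (suc i)))) * φ (suc m) (decode (drop (suc i) (false ∷ w′))) * φ (suc m) (decode v)) (sym (++-identityʳ (reverse (map bar (take (suc i) (false ∷ w′)))))))
    -- The first letter 0 has complement 1, the last letter of every collected word, so all of these
    -- decode properly.
    (sumTo-summand m false w′ [] (EndsIn1-zeros c (EndsIn1-w cs)) (true∷ []))

  seriesPartial-central : ∀ N → seriesPartial a N ≡ central (splits false w′ (true ∷ [])) N
  -- The product 2 m unfolds to m + (m + 0), hence the removal of + 0.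
  seriesPartial-central N = sumTo-cong N λ m → cong₂ (λ x k → x * recip ((suc m ℕ.+ k) C suc m)) (ψ-splits m) (ℕ.+-identityʳ (suc m))

  -- The first letter is moved separately: it is 0, and `above-false` accepts the empty second word.
  -- From then on that word is non-empty.
  ζpartial∼seriesPartial : ζpartial a ∼ seriesPartial a
  ζpartial∼seriesPartial = ∼-trans (≡⇒∼ λ N → trans (ζpartial-above N) (above-false w′ [] N))
    (∼-trans (above∼central false w′ true []) (≡⇒∼ λ N → sym (seriesPartial-central N)))

  ζpartial-tail : ∀ p k → ∣ ζpartial a (k ℕ.+ p) - ζpartial a p ∣ ≤ 4ℚ * bound w′ * rate p
  ζpartial-tail p k = begin
    ∣ ζpartial a (k ℕ.+ p) - ζpartial a p ∣ ≡⟨ cong₂ (λ x y → ∣ x - y ∣) (ζpartial-Φ (k ℕ.+ p)) (ζpartial-Φ p) ⟩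
    ∣ x - y ∣                               ≡⟨ 0≤p⇒∣p∣≡p (≤⇒0≤diff (increasing k)) ⟩
    x - y                                   ≤⟨ +-monoˡ-≤ (- y) (sumTo-Φ-false-tail w′ p k) ⟩
    (y + 4ℚ * bound w′ * rate p) - y
      ≡⟨ solve 2 (λ y z → (y :+ z) :- y := z) refl y (4ℚ * bound w′ * rate p) ⟩
    4ℚ * bound w′ * rate p                     ∎
    where
    open ≤-Reasoning
    x = sumTo (k ℕ.+ p) (Φ (false ∷ w′))
    y = sumTo p (Φ (false ∷ w′))
    increasing : ∀ k → y ≤ sumTo (k ℕ.+ p) (Φ (false ∷ w′))
    increasing zero    = ≤-refl
    increasing (suc k) = ≤-trans (increasing k) (diff⇒≤ (Φ (false ∷ w′) (suc (k ℕ.+ p))) (0≤Φ (false ∷ w′) (suc (k ℕ.+ p))) refl)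

  ζpartial-tail-≤ : ∀ {p q} → p ℕ.≤ q → ∣ ζpartial a q - ζpartial a p ∣ ≤ 4ℚ * bound w′ * rate p
  ζpartial-tail-≤ {p} {q} p≤q = subst (λ n → ∣ ζpartial a n - ζpartial a p ∣ ≤ 4ℚ * bound w′ * rate p) (ℕ.m∸n+n≡m p≤q) (ζpartial-tail p (q ℕ.∸ p))

  -- Existence of ζ(a) without real numbers: given this, a vanishing difference of partial sums
  -- means that both series have the same limit.
  ζpartial-cauchy : ∀ δ → 0ℚ < δ → ∃[ N ] (∀ p q → N ℕ.≤ p → N ℕ.≤ q → ∣ ζpartial a p - ζpartial a q ∣ < δ)
  ζpartial-cauchy δ 0<δ with N , small ← rate-null (4ℚ * bound w′) δ 0<δ = N , close
    where
    close : ∀ p q → N ℕ.≤ p → N ℕ.≤ q → ∣ ζpartial a p - ζpartial a q ∣ < δ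
    close p q N≤p N≤q with ℕ.≤-total p q
    ... | inj₂ q≤p = ≤-<-trans (ζpartial-tail-≤ q≤p) (small q N≤q)
    ... | inj₁ p≤q = subst (_< δ) (trans (sym (∣-p∣≡∣p∣ (ζpartial a q - ζpartial a p))) (cong ∣_∣ (solve 2 (λ x y → :- (x :- y)
        := y :- x)
        refl (ζpartial a q) (ζpartial a p))))
      (≤-<-trans (ζpartial-tail-≤ p≤q) (small p N≤p))

theorem6 : (c : ℕ) (cs : List ℕ) → 2 ℕ.≤ c → All (1 ℕ.≤_) cs →
    (∀ (δ : ℚ) → 0ℚ < δ → ∃[ N ] (∀ p q → N ℕ.≤ p → N ℕ.≤ q →
    ∣ ζpartial (c ∷ cs) p - ζpartial (c ∷ cs) q ∣ < δ))
    × (∀ (δ : ℚ) → 0ℚ < δ → ∃[ N ] (∀ n → N ℕ.≤ n →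
    ∣ ζpartial (c ∷ cs) n - seriesPartial (c ∷ cs) n ∣ < δ))
theorem6 (suc (suc c)) cs (s≤s (s≤s z≤n)) pos = ζpartial-cauchy c cs pos , ∼⇒close (ζpartial∼seriesPartial c cs pos)
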